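{- For all integers $n\geq 0$, $i\geq 1$ and $k\geq 3$, \begin{align*} \bar a_{2^ki-2^{k-1}-2}(8n+5)&\equiv 0 \pmod{2^{k+1}},\\ \bar a_{2^ki-2^{k-1}-2}(8n+7)&\equiv 0 \pmod{2^{k+2}}. \end{align*}
   Context: For an integer $k\geq 1$ let $f_k:=\prod_{n\geq 1}(1-q^{kn})$. For an integer $c\geq1$, the generalized overcubic partition function $\bar a_c(n)$ is defined by the generating function $\sum_{n\geq 0}\bar a_c(n)q^n=\dfrac{f_4^{c-1}}{f_1^2f_2^{2c-3}}$. -}

module Defs where

open import Data.Bool.Base using (if_then_else_)
open import Data.Fin.Base using (Fin; zero; suc; toℕ)
open import Data.Fin.Properties using (toℕ≤pred[n])
open import Data.Integer.Base as ℤ using (ℤ; +_; -[1+_])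
import Data.Integer.Properties as ℤ
open import Data.Nat.Base as ℕ using (ℕ; zero; suc; _∸_; _≤_; _<_; z≤n; s≤s; NonZero)
import Data.Nat.Properties as ℕ
open import Data.Vec.Base as Vec using (Vec; []; _∷_; head; lookup)
open import Relation.Binary.PropositionalEquality
open import Relation.Nullary.Decidable using (does; dec-false)
open import Algebra.Properties.CommutativeMonoid.Sum ℤ.+-0-commutativeMonoid
  using (sum; sum-cong-≗; sum-replicate-zero)

-- The ring ℤ⟦q⟧: s n is the coefficient of qⁿ, and equality is pointwise (_≗_).
Series : Set
Series = ℕ → ℤ

infixl 7 _·_ _÷_
infixr 8 _^_
infixl 6 _-_

q^_ : ℕ → Series
(q^ d) n = if does (d ℕ.≟ n) then + 1 else + 0

𝟏 : Series
𝟏 = q^ 0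

_-_ : Series → Series → Series
(s - t) n = s n ℤ.- t n

_·_ : Series → Series → Series
(s · t) n = sum {suc n} λ j → s (toℕ j) ℤ.* t (n ∸ toℕ j)

-- Coefficients of 1/s, for s with constant term 1 (no other s is ever
-- inverted below): g₀ = 1 and gₙ₊₁ = - ∑_{j ≤ n} sⱼ₊₁ gₙ₋ⱼ.
-- The vector lists gₙ, gₙ₋₁, …, g₀ in this order.
inverseCoeffs : Series → (n : ℕ) → Vec ℤ (suc n)
inverseCoeffs s zero    = + 1 ∷ []
inverseCoeffs s (suc n) = (ℤ.- sum (λ j → s (suc (toℕ j)) ℤ.* lookup gs j)) ∷ gs
  where gs = inverseCoeffs s n

inverse : Series → Series
inverse s n = head (inverseCoeffs s n)

_÷_ : Series → Series → Series
s ÷ t = s · inverse t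

power : Series → ℕ → Series
power s zero    = 𝟏
power s (suc e) = s · power s e

_^_ : Series → ℤ → Series
s ^ (+ e)    = power s e
s ^ -[1+ e ] = inverse (power s (suc e))

partialProduct : ℕ → ℕ → Series
partialProduct k zero    = 𝟏
partialProduct k (suc N) = (𝟏 - q^ (k ℕ.* suc N)) · partialProduct k N

-- The infinite product ∏_{n ≥ 1} (1 - qᵏⁿ), for k ≥ 1: its coefficient of qᵐ
-- is that of every partial product with N ≥ m (partialProduct-stable).
f : ℕ → Series
f k m = partialProduct k m m

-- Integer exponents, since 2c - 3 is negative for c = 1; only c ≥ 1 is meaningful.
overcubic : ℕ → ℕ → ℤ
overcubic c = f 4 ^ (+ c ℤ.- + 1)
            ÷ (f 1 ^ (+ 2) · f 2 ^ (+ 2 ℤ.* + c ℤ.- + 3))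

lookup-inverseCoeffs : ∀ s n (j : Fin (suc n)) →
                       lookup (inverseCoeffs s n) j ≡ inverse s (n ∸ toℕ j)
lookup-inverseCoeffs s zero    zero    = refl
lookup-inverseCoeffs s (suc n) zero    = refl
lookup-inverseCoeffs s (suc n) (suc j) = lookup-inverseCoeffs s n j

·-inverse : ∀ s → s 0 ≡ + 1 → s · inverse s ≗ 𝟏
·-inverse s s₀≡1 zero rewrite s₀≡1 = refl
·-inverse s s₀≡1 (suc n) = begin
  s 0 ℤ.* (ℤ.- x) ℤ.+ y  ≡⟨ cong (λ z → z ℤ.* (ℤ.- x) ℤ.+ y) s₀≡1 ⟩
  + 1 ℤ.* (ℤ.- x) ℤ.+ y  ≡⟨ cong₂ ℤ._+_ (ℤ.*-identityˡ (ℤ.- x)) (sym x≡y) ⟩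
  ℤ.- x ℤ.+ x            ≡⟨ ℤ.+-inverseˡ x ⟩
  + 0                    ∎
  where
  open ≡-Reasoning
  x = sum {suc n} λ j → s (suc (toℕ j)) ℤ.* lookup (inverseCoeffs s n) j
  y = sum {suc n} λ j → s (suc (toℕ j)) ℤ.* inverse s (n ∸ toℕ j)
  x≡y : x ≡ y
  x≡y = sum-cong-≗ λ j → cong (s (suc (toℕ j)) ℤ.*_) (lookup-inverseCoeffs s n j)

q^-below : ∀ {d n} → n < d → (q^ d) n ≡ + 0
q^-below {d} {n} n<d =
  cong (if_then + 1 else + 0) (dec-false (d ℕ.≟ n) (ℕ.>⇒≢ n<d))

[1-q^d]·-below : ∀ d s {m} → m < d → ((𝟏 - q^ d) · s) m ≡ s m
[1-q^d]·-below d s {m} m<d = begin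
  (+ 1 ℤ.- (q^ d) 0) ℤ.* s m ℤ.+ sum rest
    ≡⟨ cong₂ (λ x y → (+ 1 ℤ.- x) ℤ.* s m ℤ.+ y) (q^-below (ℕ.≤-<-trans z≤n m<d)) rest≡0 ⟩
  + 1 ℤ.* s m ℤ.+ + 0
    ≡⟨ ℤ.+-identityʳ _ ⟩
  + 1 ℤ.* s m
    ≡⟨ ℤ.*-identityˡ (s m) ⟩
  s m ∎
  where
  open ≡-Reasoning
  rest : Fin m → ℤ
  rest j = (𝟏 - q^ d) (suc (toℕ j)) ℤ.* s (m ∸ suc (toℕ j))
  rest≡0 : sum rest ≡ + 0
  rest≡0 = trans
    (sum-cong-≗ λ j → cong (λ x → (+ 0 ℤ.- x) ℤ.* s (m ∸ suc (toℕ j)))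
                           (q^-below (ℕ.≤-<-trans (toℕ≤pred[n] (suc j)) m<d)))
    (sum-replicate-zero m)

partialProduct-stable : ∀ k .{{_ : NonZero k}} {m N} → m ≤ N → partialProduct k N m ≡ f k m
partialProduct-stable k {m} m≤N = go (ℕ.≤⇒≤′ m≤N)
  where
  go : ∀ {N} → m ℕ.≤′ N → partialProduct k N m ≡ f k m
  go ℕ.≤′-refl = refl
  go {suc N} (ℕ.≤′-step m≤′N) = trans
    ([1-q^d]·-below (k ℕ.* suc N) (partialProduct k N)
      (ℕ.<-≤-trans (s≤s (ℕ.≤′⇒≤ m≤′N)) (ℕ.m≤n*m (suc N) k)))
    (go m≤′N)

{-# OPTIONS --safe #-}
module Submission where

-- Let φ(q) = ∑ q^(n²), summed over all integers n. Gauss's product φ(-q) = f₁²/f₂ turns the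
-- generating function into 1/(φ(-q) φ(-q²)^(c-1)), and φ(q) φ(-q) = φ(-q²)² turns it into
-- φ(q) φ(-q²)/φ(-q²)^(c+2). For c = 2ᵏi - 2ᵏ⁻¹ - 2 the exponent c + 2 is an odd multiple of 2ᵏ⁻¹,
-- so with φ(-q²) = 1 + 2x the denominator is 1 + 2ᵏ(x + x² + 2z), where z is even in q. With
-- φ(q) = 1 + 2v, the quotient is φ(q) φ(-q²) - 2ᵏ⁺¹ v (x + x²) modulo 2ᵏ⁺² and up to terms even
-- in q. The exponents of the first summand are of the form a² + 2b², hence never 5 or 7 modulo 8;
-- those of v (x + x²) modulo 2 are of the form a² + 2b² or a² + 4b², hence never 7 modulo 8.
--
-- Gauss's product is obtained by telescoping a finite sum (D. Shanks, Two theorems of Gauss, 1958).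

open import Defs using
  ( Series; q^_; 𝟏; _·_; inverse; _÷_; power; partialProduct; f; overcubic
  ; ·-inverse; partialProduct-stable )
import Defs
open import Algebra.Bundles using (CommutativeRing)
open import Algebra.Properties.CommutativeMonoid.Sum using (sum-cong-≗)
import Algebra.Properties.CommutativeSemiring.Exp
import Algebra.Properties.Semiring.Exp
import Algebra.Solver.Ring
open import Algebra.Solver.Ring.AlmostCommutativeRing
  using (_-Raw-AlmostCommutative⟶_; fromCommutativeRing)
open import Algebra.Structures using (IsCommutativeRing)
open import Data.Empty using (⊥; ⊥-elim)
open import Data.Fin.Base using (toℕ)
open import Data.Fin.Properties using (toℕ≤pred[n])
open import Data.Integer.Base as ℤ using (ℤ; +_)
import Data.Integer.Properties as ℤ
open import Data.Integer.Divisibility using (_∣_)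
open import Data.Integer.Divisibility.Signed using
  ( divides; 0∣⇒≡0; ∣⇒∣ᵤ; ∣-refl; ∣-trans
  ; ∣m∣n⇒∣m+n; ∣m⇒∣-m; ∣n⇒∣m*n; ∣m⇒∣m*n; *-monoʳ-∣ )
  renaming (_∣_ to _∣ˢ_)
open import Data.Integer.Solver using () renaming (module +-*-Solver to ℤ-Solver)
open import Data.List.Base using (List; []; _∷_; upTo)
open import Data.List.Membership.Propositional using (_∈_)
open import Data.List.Membership.Propositional.Properties using (∈-upTo⁺)
import Data.List.Membership.DecPropositional
import Data.List.Relation.Unary.All as All
open import Data.List.Relation.Unary.Any using (here)
open import Data.Maybe.Base as Maybe using (Maybe)
open import Data.Nat.Base as ℕ using (ℕ; zero; suc; _≤_; z≤n; s≤s; _%_; NonZero)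
import Data.Nat.DivMod as ℕ
import Data.Nat.Properties as ℕ
open import Data.Nat.Solver using () renaming (module +-*-Solver to ℕ-Solver)
open import Data.Product.Base using (∃; _×_; _,_)
open import Data.Sum.Base using (_⊎_; inj₁; inj₂)
open import Level as Level using (Level)
open import Relation.Binary.PropositionalEquality as ≡
  using (_≡_; _≗_; refl; cong; cong₂; module ≡-Reasoning)
open import Relation.Nullary using (¬_)
open import Relation.Nullary.Decidable using (True; toWitness; False; toWitnessFalse; dec⇒maybe)

open Data.List.Membership.DecPropositional ℕ._≟_ using (_∈?_)

-- Theta functions in a commutative ring

module Theta {c ℓ : Level} (R : CommutativeRing c ℓ)
  (ℤ⟶R : ℤ.+-*-rawRing -Raw-AlmostCommutative⟶ fromCommutativeRing R) where

  open CommutativeRing R hiding (zero; refl)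
  open CommutativeRing R using () renaming (refl to ≈-refl)
  open Algebra.Properties.Semiring.Exp semiring
  open Algebra.Properties.CommutativeSemiring.Exp commutativeSemiring using (^-distrib-*)
  open _-Raw-AlmostCommutative⟶_ ℤ⟶R using () renaming (⟦_⟧ to ι)
  open import Relation.Binary.Reasoning.Setoid setoid

  ι-≟ : (a b : ℤ) → Maybe (ι a ≈ ι b)
  ι-≟ a b = Maybe.map (λ { ≡.refl → ≈-refl }) (dec⇒maybe (a ℤ.≟ b))

  open Algebra.Solver.Ring ℤ.+-*-rawRing (fromCommutativeRing R) ℤ⟶R ι-≟
    using (solve; _:=_; Polynomial; con; _:+_; _:*_; :-_; _:-_; _:^_)

  -- Evaluates to 1# on the nose, whereas con (+ 1) evaluates to ι (+ 1).
  :1 : ∀ {n} → Polynomial n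
  :1 = con (+ 0) :^ 0

  unit-cancelˡ : ∀ {u d x y} → u * d ≈ 1# → d * x ≈ d * y → x ≈ y
  unit-cancelˡ {u} {d} {x} {y} ud≈1 dx≈dy = begin
    x           ≈⟨ sym (*-identityˡ x) ⟩
    1# * x      ≈⟨ *-congʳ (sym ud≈1) ⟩
    u * d * x   ≈⟨ *-assoc u d x ⟩
    u * (d * x) ≈⟨ *-congˡ dx≈dy ⟩
    u * (d * y) ≈⟨ sym (*-assoc u d y) ⟩
    u * d * y   ≈⟨ *-congʳ ud≈1 ⟩
    1# * y      ≈⟨ *-identityˡ y ⟩
    y           ∎

  inverse-unique : ∀ {u v d} → u * d ≈ 1# → v * d ≈ 1# → u ≈ v
  inverse-unique {u} {v} {d} ud≈1 vd≈1 =
    unit-cancelˡ ud≈1 (trans (*-comm d u) (trans ud≈1 (trans (sym vd≈1) (*-comm v d))))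

  -- A general commutative ring has no division, so the inverses of 1 + xˢ for s ≥ 1 are supplied as
  -- data.
  Inverses : Carrier → (ℕ → Carrier) → Set ℓ
  Inverses x u = ∀ n → u n * (1# + x ^ suc n) ≈ 1#

  -- Gauss's product by a telescoping sum

  sgn : ℕ → Carrier
  sgn zero    = 1#
  sgn (suc n) = - sgn n

  -- Half of the nonconstant part of φ(-x), kept apart because the congruences rest on φ being 1
  -- plus twice a series.
  squares : Carrier → ℕ → Carrier
  squares x zero    = 0#
  squares x (suc n) = squares x n + sgn (suc n) * x ^ (suc n ℕ.* suc n)

  theta : Carrier → ℕ → Carrier
  theta x n = 1# + (squares x n + squares x n)

  euler : Carrier → ℕ → Carrier
  euler x zero    = 1#
  euler x (suc n) = (1# - x ^ suc n) * euler x n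

  -- A finite form of f₁²/f₂ at q = x.
  ratio : Carrier → (ℕ → Carrier) → ℕ → Carrier
  ratio x u zero    = 1#
  ratio x u (suc n) = (1# - x ^ suc n) * u n * ratio x u n

  -- ∑_{s ≤ n} (-1)ˢ (Qₙ/Qₛ) (2/(1 + xˢ)) xˢᵐ, where Qₙ = ratio x u n
  shanks : Carrier → (ℕ → Carrier) → ℕ → ℕ → Carrier
  shanks x u zero    m = 1#
  shanks x u (suc n) m =
    (1# - x ^ suc n) * u n * shanks x u n m +
    (sgn (suc n) + sgn (suc n)) * (x ^ (suc n ℕ.* m) * u n)

  -- Since xˢ(1 - xᵐ) - (1 + xᵐ) = -(1 - xˢ) - xᵐ(1 + xˢ), the summands with s ≥ 1 contribute to the
  -- difference of the two sides consecutive differences of -2(-1)ˢ (Qₙ/Qₛ) x^((s+1)m). The summand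
  -- s = 0 cancels the lower boundary value, and the upper one is the extra term on the left. The
  -- induction on n avoids dividing by Qₛ.
  shanks-suc : ∀ {x u} → Inverses x u → ∀ n m →
    shanks x u n (suc m) * (1# - x ^ m) + (sgn n + sgn n) * x ^ (suc n ℕ.* m) ≈
    shanks x u n m * (1# + x ^ m)
  shanks-suc {x} {u} u-inv zero m = begin
    1# * (1# - x ^ m) + (1# + 1#) * x ^ (m ℕ.+ 0)
      ≈⟨ +-congˡ (*-congˡ (^-congʳ x (ℕ.+-identityʳ m))) ⟩
    1# * (1# - x ^ m) + (1# + 1#) * x ^ m
      ≈⟨ solve 1 (λ y → :1 :* (:1 :- y) :+ (:1 :+ :1) :* y := :1 :* (:1 :+ y)) ≈-refl (x ^ m) ⟩
    1# * (1# + x ^ m) ∎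
  shanks-suc {x} {u} u-inv (suc n) m = begin
    ((1# - X) * v * ρ′ + (- e + - e) * (x ^ (suc n ℕ.* suc m) * v)) * (1# - Y)
      + (- e + - e) * x ^ (m ℕ.+ suc n ℕ.* m)
      ≈⟨ +-cong (*-congʳ (+-congˡ (*-congˡ (*-congʳ x^[n+1][m+1]≈XZ))))
                (*-congˡ (^-homo-* x m (suc n ℕ.* m))) ⟩
    ((1# - X) * v * ρ′ + (- e + - e) * (X * Z * v)) * (1# - Y) + (- e + - e) * (Y * Z)
      -- Inserting `v * (1# + X)`, which equals 1, turns the next equality into a polynomial
      -- identity.
      ≈⟨ +-congˡ (sym (trans (*-congʳ (u-inv n)) (*-identityˡ _))) ⟩
    ((1# - X) * v * ρ′ + (- e + - e) * (X * Z * v)) * (1# - Y)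
      + v * (1# + X) * ((- e + - e) * (Y * Z))
      ≈⟨ solve 6 (λ X Y Z v e ρ′ →
           ((:1 :- X) :* v :* ρ′ :+ (:- e :+ :- e) :* (X :* Z :* v)) :* (:1 :- Y)
             :+ v :* (:1 :+ X) :* ((:- e :+ :- e) :* (Y :* Z))
           := (:1 :- X) :* v :* (ρ′ :* (:1 :- Y) :+ (e :+ e) :* Z)
             :+ (:- e :+ :- e) :* (Z :* v) :* (:1 :+ Y)) ≈-refl X Y Z v e ρ′ ⟩
    (1# - X) * v * (ρ′ * (1# - Y) + (e + e) * Z) + (- e + - e) * (Z * v) * (1# + Y)
      ≈⟨ +-congʳ (*-congˡ (shanks-suc u-inv n m)) ⟩
    (1# - X) * v * (ρ * (1# + Y)) + (- e + - e) * (Z * v) * (1# + Y)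
      ≈⟨ trans (+-congʳ (sym (*-assoc _ ρ (1# + Y)))) (sym (distribʳ (1# + Y) _ _)) ⟩
    ((1# - X) * v * ρ + (- e + - e) * (Z * v)) * (1# + Y) ∎
    where
    X = x ^ suc n
    Y = x ^ m
    Z = x ^ (suc n ℕ.* m)
    v = u n
    e = sgn n
    ρ = shanks x u n m
    ρ′ = shanks x u n (suc m)
    x^[n+1][m+1]≈XZ : x ^ (suc n ℕ.* suc m) ≈ X * Z
    x^[n+1][m+1]≈XZ = trans (^-congʳ x (ℕ.*-suc (suc n) m)) (^-homo-* x (suc n) (suc n ℕ.* m))

  -- On the diagonal m = n + 1 the boundary term of `shanks-suc` has exponent (n + 1)², so each step
  -- adds exactly one term of the theta series.
  shanks≈theta : ∀ {x u} → Inverses x u → ∀ n → shanks x u n (suc n) ≈ theta x n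
  shanks≈theta u-inv zero = sym (trans (+-congˡ (+-identityˡ 0#)) (+-identityʳ 1#))
  shanks≈theta {x} {u} u-inv (suc n) = begin
    (1# - X) * v * ρ′ + (- e + - e) * (x ^ (suc n ℕ.* suc (suc n)) * v)
      ≈⟨ +-congˡ (*-congˡ (*-congʳ (trans (^-congʳ x (ℕ.*-suc (suc n) (suc n)))
                                          (^-homo-* x (suc n) (suc n ℕ.* suc n))))) ⟩
    (1# - X) * v * ρ′ + (- e + - e) * (X * S * v)
      ≈⟨ solve 5 (λ X S v e ρ′ →
           (:1 :- X) :* v :* ρ′ :+ (:- e :+ :- e) :* (X :* S :* v)
           := v :* (ρ′ :* (:1 :- X) :+ (e :+ e) :* S)
             :+ v :* (:1 :+ X) :* ((:- e :+ :- e) :* S)) ≈-refl X S v e ρ′ ⟩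
    v * (ρ′ * (1# - X) + (e + e) * S) + v * (1# + X) * ((- e + - e) * S)
      ≈⟨ +-congʳ (*-congˡ (trans (shanks-suc u-inv n (suc n)) (*-congʳ (shanks≈theta u-inv n)))) ⟩
    v * (theta x n * (1# + X)) + v * (1# + X) * ((- e + - e) * S)
      ≈⟨ solve 5 (λ X S v e a →
           v :* ((:1 :+ (a :+ a)) :* (:1 :+ X)) :+ v :* (:1 :+ X) :* ((:- e :+ :- e) :* S)
           := v :* (:1 :+ X) :* (:1 :+ ((a :+ :- e :* S) :+ (a :+ :- e :* S))))
         ≈-refl X S v e (squares x n) ⟩
    v * (1# + X) * theta x (suc n)
      ≈⟨ trans (*-congʳ (u-inv n)) (*-identityˡ _) ⟩
    theta x (suc n) ∎
    where
    X = x ^ suc n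
    S = x ^ (suc n ℕ.* suc n)
    v = u n
    e = sgn n
    ρ′ = shanks x u n (suc (suc n))

  -- The summands with s ≥ 1 contain the vanishing power xᵐ; the summand s = 0 is Qₙ.
  shanks≈ratio : ∀ {x u m} → x ^ m ≈ 0# → ∀ n → shanks x u n m ≈ ratio x u n
  shanks≈ratio x^m≈0 zero = ≈-refl
  shanks≈ratio {x} {u} {m} x^m≈0 (suc n) = begin
    (1# - x ^ suc n) * u n * shanks x u n m + e * (x ^ (m ℕ.+ n ℕ.* m) * u n)
      ≈⟨ +-cong (*-congˡ (shanks≈ratio x^m≈0 n)) (*-congˡ (*-congʳ x^[m+nm]≈0)) ⟩
    ratio x u (suc n) + e * (0# * u n)
      ≈⟨ +-congˡ (trans (*-congˡ (zeroˡ (u n))) (zeroʳ e)) ⟩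
    ratio x u (suc n) + 0#
      ≈⟨ +-identityʳ _ ⟩
    ratio x u (suc n) ∎
    where
    e = sgn (suc n) + sgn (suc n)
    x^[m+nm]≈0 : x ^ (m ℕ.+ n ℕ.* m) ≈ 0#
    x^[m+nm]≈0 = trans (^-homo-* x m (n ℕ.* m)) (trans (*-congʳ x^m≈0) (zeroˡ _))

  theta≈ratio : ∀ {x u} → Inverses x u → ∀ n → x ^ suc n ≈ 0# → theta x n ≈ ratio x u n
  theta≈ratio u-inv n x^[n+1]≈0 = trans (sym (shanks≈theta u-inv n)) (shanks≈ratio x^[n+1]≈0 n)

  -- Factor by factor, (1 - X)/(1 + X) times 1 - X² is (1 - X)².
  ratio*euler : ∀ {x u} → Inverses x u → ∀ n →
                ratio x u n * euler (x * x) n ≈ euler x n * euler x n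
  ratio*euler u-inv zero = ≈-refl
  ratio*euler {x} {u} u-inv (suc n) = begin
    (1# - X) * v * r * ((1# - (x * x) ^ suc n) * E)
      ≈⟨ *-congˡ (*-congʳ (+-congˡ (-‿cong (^-distrib-* x x (suc n))))) ⟩
    (1# - X) * v * r * ((1# - X * X) * E)
      ≈⟨ solve 4 (λ X v r E →
           (:1 :- X) :* v :* r :* ((:1 :- X :* X) :* E)
           := v :* (:1 :+ X) :* ((:1 :- X) :* (:1 :- X) :* (r :* E))) ≈-refl X v r E ⟩
    v * (1# + X) * ((1# - X) * (1# - X) * (r * E))
      ≈⟨ trans (*-congʳ (u-inv n)) (*-identityˡ _) ⟩
    (1# - X) * (1# - X) * (r * E)
      ≈⟨ *-congˡ (ratio*euler u-inv n) ⟩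
    (1# - X) * (1# - X) * (F * F)
      ≈⟨ solve 2 (λ X F → (:1 :- X) :* (:1 :- X) :* (F :* F)
                          := (:1 :- X) :* F :* ((:1 :- X) :* F)) ≈-refl X F ⟩
    (1# - X) * F * ((1# - X) * F) ∎
    where
    X = x ^ suc n
    v = u n
    r = ratio x u n
    E = euler (x * x) n
    F = euler x n

  -- The identity φ(q) φ(-q) = φ(-q²)²

  neg-*-neg : ∀ x → (- x) * (- x) ≈ x * x
  neg-*-neg = solve 1 (λ x → (:- x) :* (:- x) := x :* x) ≈-refl

  ^-double : ∀ x n → x ^ (n ℕ.* 2) ≈ (x * x) ^ n
  ^-double x zero    = ≈-refl
  ^-double x (suc n) = trans (sym (*-assoc x x _)) (*-congˡ (^-double x n))

  neg-^-double : ∀ x n → (- x) ^ (n ℕ.* 2) ≈ x ^ (n ℕ.* 2)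
  neg-^-double x n =
    trans (^-double (- x) n) (trans (^-congˡ n (neg-*-neg x)) (sym (^-double x n)))

  -- Under x ↦ -x the factor (1 - xˢ)/(1 + xˢ) is inverted for odd s and unchanged for even s. So
  -- the odd factors cancel and the even ones, which are those of x², appear twice.
  ratio-neg : ∀ {x u u⁻ u²} → Inverses x u → Inverses (- x) u⁻ → Inverses (x * x) u² → ∀ n →
    ratio x u (n ℕ.* 2) * ratio (- x) u⁻ (n ℕ.* 2) ≈ ratio (x * x) u² n * ratio (x * x) u² n
  ratio-neg u-inv u⁻-inv u²-inv zero = ≈-refl
  ratio-neg {x} {u} {u⁻} {u²} u-inv u⁻-inv u²-inv (suc n) = begin
    (1# - x ^ suc (suc n2)) * u (suc n2) * ((1# - X) * v * r)
      * ((1# - (- x) ^ suc (suc n2)) * u⁻ (suc n2) * ((1# - (- x) ^ suc n2) * w * s))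
      ≈⟨ *-cong
           (*-congʳ (*-cong (+-congˡ (-‿cong (^-double x (suc n)))) u≈u²))
           (*-cong (*-cong (+-congˡ (-‿cong (trans (neg-^-double x (suc n)) (^-double x (suc n))))) u⁻≈u²)
                   (*-congʳ (*-congʳ (+-congˡ (-‿cong -x^odd))))) ⟩
    (1# - Y) * t * ((1# - X) * v * r) * ((1# - Y) * t * ((1# - - X) * w * s))
      ≈⟨ solve 7 (λ X Y t v w r s →
           (:1 :- Y) :* t :* ((:1 :- X) :* v :* r) :* ((:1 :- Y) :* t :* ((:1 :- :- X) :* w :* s))
           := v :* (:1 :+ X) :* (w :* (:1 :+ :- X))
             :* ((:1 :- Y) :* t :* ((:1 :- Y) :* t) :* (r :* s))) ≈-refl X Y t v w r s ⟩
    v * (1# + X) * (w * (1# + - X)) * ((1# - Y) * t * ((1# - Y) * t) * (r * s))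
      ≈⟨ *-cong (*-cong (u-inv n2) (trans (*-congˡ (+-congˡ (sym -x^odd))) (u⁻-inv n2)))
                (*-congˡ (ratio-neg u-inv u⁻-inv u²-inv n)) ⟩
    1# * 1# * ((1# - Y) * t * ((1# - Y) * t) * (p * p))
      ≈⟨ solve 3 (λ Y t p →
           :1 :* :1 :* ((:1 :- Y) :* t :* ((:1 :- Y) :* t) :* (p :* p))
           := (:1 :- Y) :* t :* p :* ((:1 :- Y) :* t :* p)) ≈-refl Y t p ⟩
    (1# - Y) * t * p * ((1# - Y) * t * p) ∎
    where
    n2 = n ℕ.* 2
    X = x ^ suc n2
    Y = (x * x) ^ suc n
    t = u² n
    v = u n2
    w = u⁻ n2
    r = ratio x u n2
    s = ratio (- x) u⁻ n2
    p = ratio (x * x) u² n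
    -x^odd : (- x) ^ suc n2 ≈ - X
    -x^odd = trans (*-congˡ (neg-^-double x n))
                   (solve 2 (λ x y → (:- x) :* y := :- (x :* y)) ≈-refl x (x ^ n2))
    -- The three families of inverses are unrelated data; at even exponents they are identified by
    -- uniqueness of inverses.
    u≈u² : u (suc n2) ≈ t
    u≈u² = inverse-unique (trans (*-congˡ (+-congˡ (sym (^-double x (suc n))))) (u-inv (suc n2)))
                          (u²-inv n)
    u⁻≈u² : u⁻ (suc n2) ≈ t
    u⁻≈u² = inverse-unique
      (trans (*-congˡ (+-congˡ (trans (sym (^-double x (suc n))) (sym (neg-^-double x (suc n))))))
             (u⁻-inv (suc n2)))
      (u²-inv n)

  -- The cross term appears as a visible double, to be discarded modulo 2.
  square-+ : ∀ x y → x * x + y * y + (x * y + x * y) ≈ (x + y) * (x + y)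
  square-+ = solve 2 (λ x y → x :* x :+ y :* y :+ (x :* y :+ x :* y) := (x :+ y) :* (x :+ y)) ≈-refl

  -- Built by doubling, so that in the ring solver `pow2 (2 ℕ.+ j)` can be written as a sum of four
  -- copies of `pow2 j`.
  pow2 : ℕ → Carrier
  pow2 zero    = 1#
  pow2 (suc j) = pow2 j + pow2 j

  -- The generating function as a theta quotient

  ^-unit : ∀ {u d} → u * d ≈ 1# → ∀ n → u ^ n * d ^ n ≈ 1#
  ^-unit {u} {d} ud≈1 n = trans (sym (^-distrib-* u d n)) (trans (^-congˡ n ud≈1) (1^n≈1 n))
    where
    1^n≈1 : ∀ n → 1# ^ n ≈ 1#
    1^n≈1 zero    = ≈-refl
    1^n≈1 (suc n) = trans (*-identityˡ _) (1^n≈1 n)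

  -- Here c = e + 2, and T, V, U stand for φ(-q), φ(q), φ(-q²). The defining quotient amounts to G T
  -- U^(c-1) = 1; multiplying by V U and replacing T V by U² gives the claim.
  theta-quotient : ∀ {G F₁ F₂ F₄ f₄⁻¹ T U V} →
    f₄⁻¹ * F₄ ≈ 1# → T * F₂ ≈ F₁ * F₁ → U * F₄ ≈ F₂ * F₂ → T * V ≈ U * U →
    ∀ e → G * (F₁ ^ 2 * F₂ ^ (1 ℕ.+ e ℕ.* 2)) ≈ F₄ ^ (1 ℕ.+ e) →
    G * U ^ (4 ℕ.+ e) ≈ V * U
  theta-quotient {G} {F₁} {F₂} {F₄} {f₄⁻¹} {T} {U} {V} f₄-unit TF₂ UF₄ TV e G-def = begin
    G * (U * (U * (U * (U * D))))
      ≈⟨ solve 3 (λ G U D → G :* (U :* (U :* (U :* (U :* D))))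
                            := G :* (U :* U) :* (U :* D) :* U) ≈-refl G U D ⟩
    G * (U * U) * (U * D) * U
      ≈⟨ *-congʳ (*-congʳ (*-congˡ (sym TV))) ⟩
    G * (T * V) * (U * D) * U
      ≈⟨ solve 5 (λ G T V U D → G :* (T :* V) :* (U :* D) :* U
                                := G :* T :* (U :* D) :* (V :* U)) ≈-refl G T V U D ⟩
    G * T * U ^ suc e * (V * U)
      ≈⟨ trans (*-congʳ GTU≈1) (*-identityˡ _) ⟩
    V * U ∎
    where
    D = U ^ e
    GTU≈1 : G * T * U ^ suc e ≈ 1#
    -- By the product formulas for T and U, multiplication by the unit F₄^(e+1) leads back to the
    -- hypothesis on G.
    GTU≈1 = unit-cancelˡ (^-unit f₄-unit (suc e)) (begin
      F₄ ^ suc e * (G * T * U ^ suc e)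
        ≈⟨ solve 4 (λ P G T Q → P :* (G :* T :* Q) := G :* T :* (Q :* P))
             ≈-refl (F₄ ^ suc e) G T (U ^ suc e) ⟩
      G * T * (U ^ suc e * F₄ ^ suc e)
        ≈⟨ *-congˡ (trans (sym (^-distrib-* U F₄ (suc e)))
                          (trans (^-congˡ (suc e) UF₄) (sym (^-double F₂ (suc e))))) ⟩
      G * T * (F₂ * (F₂ * F₂ ^ (e ℕ.* 2)))
        ≈⟨ solve 4 (λ G T F P → G :* T :* (F :* P) := G :* (T :* F :* P))
             ≈-refl G T F₂ (F₂ * F₂ ^ (e ℕ.* 2)) ⟩
      G * (T * F₂ * F₂ ^ suc (e ℕ.* 2))
        ≈⟨ *-congˡ (*-congʳ (trans TF₂ (*-congˡ (sym (*-identityʳ F₁))))) ⟩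
      G * (F₁ ^ 2 * F₂ ^ suc (e ℕ.* 2))
        ≈⟨ G-def ⟩
      F₄ ^ suc e
        ≈⟨ sym (*-identityʳ _) ⟩
      F₄ ^ suc e * 1# ∎)

  -- Powers of 1 + 2x modulo powers of two

  module _ {e : Level} (E : Carrier → Set e)
    (0∈E : E 0#) (1∈E : E 1#)
    (+∈E : ∀ {x y} → E x → E y → E (x + y)) (*∈E : ∀ {x y} → E x → E y → E (x * y)) where

    pow2∈E : ∀ j → E (pow2 j)
    pow2∈E zero    = 1∈E
    pow2∈E (suc j) = +∈E (pow2∈E j) (pow2∈E j)

    -- Fixes X modulo 2p through y; of the remaining error z only membership in `E` is recorded,
    -- which later means being even in q.
    Near : Carrier → Carrier → Carrier → Set (c Level.⊔ ℓ Level.⊔ e)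
    Near p y X = ∃ λ z → E z × X ≈ 1# + p * (y + (z + z))

    Near-cong : ∀ {p y X X′} → X′ ≈ X → Near p y X → Near p y X′
    Near-cong X′≈X (z , z∈E , X≈) = z , z∈E , trans X′≈X X≈

    -- (1 + pW)² = 1 + 2p(W + (p/2)W²), and p/2 is even because p is a multiple of 4. So y survives
    -- and W² goes into the error.
    Near-square : ∀ {y X} j → E y → Near (pow2 (2 ℕ.+ j)) y X → Near (pow2 (3 ℕ.+ j)) y (X * X)
    Near-square {y} {X} j y∈E (z , z∈E , X≈) =
      z + h * (W * W) , +∈E z∈E (*∈E (pow2∈E j) (*∈E W∈E W∈E)) , trans (*-cong X≈ X≈)
        (solve 3 (λ h y z →
          let p = (h :+ h) :+ (h :+ h); W = y :+ (z :+ z); z′ = z :+ h :* (W :* W) in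
          (:1 :+ p :* W) :* (:1 :+ p :* W) := :1 :+ (p :+ p) :* (y :+ (z′ :+ z′))) ≈-refl h y z)
      where
      h = pow2 j
      W = y + (z + z)
      W∈E : E W
      W∈E = +∈E y∈E (+∈E z∈E z∈E)

    Near-even-power : ∀ {y X} j → E y → Near (pow2 (2 ℕ.+ j)) y X →
      ∀ i → ∃ λ b → E b × (X * X) ^ i ≈ 1# + pow2 (3 ℕ.+ j) * b
    Near-even-power j y∈E X-near zero =
      0# , 0∈E , sym (trans (+-congˡ (zeroʳ _)) (+-identityʳ 1#))
    Near-even-power {y} j y∈E X-near (suc i)
      with z , z∈E , X²≈ ← Near-square j y∈E X-near
         | b , b∈E , P≈ ← Near-even-power j y∈E X-near i =
      a + b + p * (a * b) , +∈E (+∈E a∈E b∈E) (*∈E (pow2∈E (3 ℕ.+ j)) (*∈E a∈E b∈E)) ,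
      trans (*-cong X²≈ P≈)
        (solve 3 (λ p a b → (:1 :+ p :* a) :* (:1 :+ p :* b) := :1 :+ p :* (a :+ b :+ p :* (a :* b)))
          ≈-refl p a b)
      where
      p = pow2 (3 ℕ.+ j)
      a = y + (z + z)
      a∈E : E a
      a∈E = +∈E y∈E (+∈E z∈E z∈E)

    -- By `Near-even-power` the factor (X²)ⁱ is 1 modulo 2p, so multiplying by it changes only z.
    Near-odd-power : ∀ {y X} j → E y → Near (pow2 (2 ℕ.+ j)) y X →
                     ∀ i → Near (pow2 (2 ℕ.+ j)) y (X * (X * X) ^ i)
    Near-odd-power {y} {X} j y∈E X-near@(z , z∈E , X≈) i
      with b , b∈E , P≈ ← Near-even-power j y∈E X-near i =
      z + b * (1# + p * W) ,
      +∈E z∈E (*∈E b∈E (+∈E 1∈E (*∈E (pow2∈E (2 ℕ.+ j)) (+∈E y∈E (+∈E z∈E z∈E))))) ,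
      trans (*-cong X≈ P≈)
        (solve 4 (λ p y z b →
          let W = y :+ (z :+ z); z′ = z :+ b :* (:1 :+ p :* W) in
          (:1 :+ p :* W) :* (:1 :+ (p :+ p) :* b) := :1 :+ p :* (y :+ (z′ :+ z′))) ≈-refl p y z b)
      where
      p = pow2 (2 ℕ.+ j)
      W = y + (z + z)

    -- The first squaring gives (1 + 2x)² = 1 + 4(x + x²). The next j squarings double the modulus
    -- and keep y = x + x², and the odd exponent keeps both.
    Near-power : ∀ {x} → E x → ∀ j i →
      Near (pow2 (2 ℕ.+ j)) (x + x * x) ((1# + (x + x)) ^ (2 ℕ.^ suc j ℕ.* suc (2 ℕ.* i)))
    Near-power {x} x∈E j i = Near-cong U^[ab]≈ (Near-odd-power j y∈E (go j) i)
      where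
      U = 1# + (x + x)
      y∈E : E (x + x * x)
      y∈E = +∈E x∈E (*∈E x∈E x∈E)
      ^-twice : ∀ m → U ^ (2 ℕ.* m) ≈ U ^ m * U ^ m
      ^-twice m = trans (^-congʳ U (≡.cong (m ℕ.+_) (ℕ.+-identityʳ m))) (^-homo-* U m m)
      go : ∀ j → Near (pow2 (2 ℕ.+ j)) (x + x * x) (U ^ (2 ℕ.^ suc j))
      go zero = 0# , 0∈E , (begin
        U * (U * 1#)
          ≈⟨ solve 1 (λ x → let U = :1 :+ (x :+ x) in
               U :* (U :* :1) := :1 :+ (:1 :+ :1 :+ (:1 :+ :1)) :* (x :+ x :* x)) ≈-refl x ⟩
        1# + pow2 2 * (x + x * x)
          ≈⟨ +-congˡ (*-congˡ (sym (trans (+-congˡ (+-identityʳ 0#)) (+-identityʳ _)))) ⟩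
        1# + pow2 2 * (x + x * x + (0# + 0#)) ∎)
      go (suc j) = Near-cong (^-twice (2 ℕ.^ suc j)) (Near-square j y∈E (go j))
      a = 2 ℕ.^ suc j
      U^[ab]≈ : U ^ (a ℕ.* suc (2 ℕ.* i)) ≈ U ^ a * (U ^ a * U ^ a) ^ i
      U^[ab]≈ = begin
        U ^ (a ℕ.* suc (2 ℕ.* i))     ≈⟨ sym (^-assocʳ U a (suc (2 ℕ.* i))) ⟩
        U ^ a * (U ^ a) ^ (2 ℕ.* i)   ≈⟨ *-congˡ (^-congʳ (U ^ a) (ℕ.*-comm 2 i)) ⟩
        U ^ a * (U ^ a) ^ (i ℕ.* 2)   ≈⟨ *-congˡ (^-double (U ^ a) i) ⟩
        U ^ a * (U ^ a * U ^ a) ^ i   ∎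

  -- Multiplying G (1 + pW) = VU by 1 - pW gives G = VU - pW VU + p²W² G; here p² is divisible by 4p.
  expansion : ∀ {G X v x y z} j → let V = 1# + (v + v); U = 1# + (x + x); p = pow2 (2 ℕ.+ j) in
    G * X ≈ V * U → X ≈ 1# + p * (y + (z + z)) →
    ∃ λ H → G ≈ V * U + p * (- ((y + (z + z)) * U)) + (p + p) * (- (v * y)) + (p + p + (p + p)) * H
  expansion {G} {X} {v} {x} {y} {z} j GX≈VU X≈ = H , (begin
    G
      ≈⟨ solve 3 (λ G p W → let Y = :1 :+ p :* W in
           G := G :* Y :+ p :* (:- (W :* (G :* Y))) :+ p :* p :* (W :* W :* G)) ≈-refl G p W ⟩
    G * (1# + p * W) + p * (- (W * (G * (1# + p * W)))) + p * p * (W * W * G)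
      ≈⟨ +-congʳ (+-cong GY≈VU (*-congˡ (-‿cong (*-congˡ GY≈VU)))) ⟩
    V * U + p * (- (W * (V * U))) + p * p * (W * W * G)
      -- The part 2v of V contributes 2pvWU. In it the 2z of W and the 2x of U yield multiples of
      -- 4p, absorbed by H, and only 2pvy is left.
      ≈⟨ solve 6 (λ G h v x y z →
           let p = (h :+ h) :+ (h :+ h); W = y :+ (z :+ z); V = :1 :+ (v :+ v); U = :1 :+ (x :+ x) in
           V :* U :+ p :* (:- (W :* (V :* U))) :+ p :* p :* (W :* W :* G)
           := V :* U :+ p :* (:- (W :* U)) :+ (p :+ p) :* (:- (v :* y))
             :+ (p :+ p :+ (p :+ p)) :* (h :* (W :* W :* G) :- (v :* y :* x :+ v :* z :* U)))
         ≈-refl G h v x y z ⟩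
    V * U + p * (- (W * U)) + (p + p) * (- (v * y)) + (p + p + (p + p)) * H ∎)
    where
    h = pow2 j
    p = pow2 (2 ℕ.+ j)
    W = y + (z + z)
    V = 1# + (v + v)
    U = 1# + (x + x)
    H = h * (W * W * G) - (v * y * x + v * z * U)
    GY≈VU : G * (1# + p * W) ≈ V * U
    GY≈VU = trans (*-congˡ (sym X≈)) GX≈VU

-- Power series

infixl 6 _⊕_
infixl 7 _⊛_
infix  8 ⊖_

-- Opaque, since unification would otherwise unfold them coefficientwise.
opaque
  _⊕_ : Series → Series → Series
  (s ⊕ t) n = s n ℤ.+ t n

  ⊖_ : Series → Series
  (⊖ s) n = ℤ.- s n

  _⊛_ : Series → Series → Series
  _⊛_ = _·_

constant : ℤ → Series
constant a zero    = a
constant a (suc n) = + 0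

scale : ℤ → Series → Series
scale a s n = a ℤ.* s n

-- `(s · t) (suc n)` unfolds to `s 0 ℤ.* t (suc n)` plus `(tail s · t) n`; most of the ring laws
-- below are inductions along this recursion.
tail : Series → Series
tail s n = s (suc n)

module _ where
  open ℤ-Solver

  opaque
    unfolding _⊕_ ⊖_ _⊛_

    ·-zeroˡ : ∀ s n → ((λ _ → + 0) · s) n ≡ + 0
    ·-zeroˡ s zero    = refl
    ·-zeroˡ s (suc n) = ≡.trans (ℤ.+-identityˡ _) (·-zeroˡ s n)

    ·-identityˡ : ∀ s → 𝟏 · s ≗ s
    ·-identityˡ s zero    = ≡.trans (ℤ.+-identityʳ _) (ℤ.*-identityˡ _)
    ·-identityˡ s (suc n) = ≡.trans (cong (ℤ._+_ (+ 1 ℤ.* s (suc n))) (·-zeroˡ s n))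
                                    (≡.trans (ℤ.+-identityʳ _) (ℤ.*-identityˡ _))

    ·-distribʳ : ∀ u s t → (s ⊕ t) · u ≗ s · u ⊕ t · u
    ·-distribʳ u s t zero = solve 3 (λ a b c → (a :+ b) :* c :+ con (+ 0)
      := (a :* c :+ con (+ 0)) :+ (b :* c :+ con (+ 0))) refl (s 0) (t 0) (u 0)
    ·-distribʳ u s t (suc n) = ≡.trans
      (cong (ℤ._+_ ((s 0 ℤ.+ t 0) ℤ.* u (suc n))) (·-distribʳ u (tail s) (tail t) n))
      (solve 5 (λ a b c d e → (a :+ b) :* c :+ (d :+ e) := (a :* c :+ d) :+ (b :* c :+ e)) refl
        (s 0) (t 0) (u (suc n)) ((tail s · u) n) ((tail t · u) n))

    scale-· : ∀ a s t → scale a s · t ≗ scale a (s · t)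
    scale-· a s t zero = solve 3 (λ a b c → a :* b :* c :+ con (+ 0)
      := a :* (b :* c :+ con (+ 0))) refl a (s 0) (t 0)
    scale-· a s t (suc n) = ≡.trans (cong (ℤ._+_ (a ℤ.* s 0 ℤ.* t (suc n))) (scale-· a (tail s) t n))
      (solve 4 (λ a b c d → a :* b :* c :+ a :* d := a :* (b :* c :+ d)) refl
        a (s 0) (t (suc n)) ((tail s · t) n))

    -- The tail of `s · t` is `scale (s 0) (tail t) ⊕ tail s · t`, hence the use of distributivity
    -- and `scale-·`.
    ·-assoc : ∀ s t u → (s · t) · u ≗ s · (t · u)
    ·-assoc s t u zero = solve 3 (λ a b c → (a :* b :+ con (+ 0)) :* c :+ con (+ 0)
      := a :* (b :* c :+ con (+ 0)) :+ con (+ 0)) refl (s 0) (t 0) (u 0)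
    ·-assoc s t u (suc n) = begin
      (s 0 ℤ.* t 0 ℤ.+ + 0) ℤ.* u (suc n) ℤ.+ ((scale (s 0) (tail t) ⊕ tail s · t) · u) n
        ≡⟨ cong (ℤ._+_ ((s 0 ℤ.* t 0 ℤ.+ + 0) ℤ.* u (suc n)))
             (≡.trans (·-distribʳ u (scale (s 0) (tail t)) (tail s · t) n)
                      (cong₂ ℤ._+_ (scale-· (s 0) (tail t) u n) (·-assoc (tail s) t u n))) ⟩
      (s 0 ℤ.* t 0 ℤ.+ + 0) ℤ.* u (suc n) ℤ.+ (s 0 ℤ.* (tail t · u) n ℤ.+ (tail s · (t · u)) n)
        ≡⟨ solve 5 (λ a b c d e → (a :* b :+ con (+ 0)) :* c :+ (a :* d :+ e)
                                  := a :* (b :* c :+ d) :+ e) refl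
             (s 0) (t 0) (u (suc n)) ((tail t · u) n) ((tail s · (t · u)) n) ⟩
      (s · (t · u)) (suc n) ∎
      where open ≡-Reasoning

    -- Splits off the last summand instead of the first; commutativity exchanges the two splittings.
    ·-suc : ∀ s t n → (s · t) (suc n) ≡ (s · tail t) n ℤ.+ s (suc n) ℤ.* t 0
    ·-suc s t zero = solve 4 (λ a b c d → a :* b :+ (c :* d :+ con (+ 0))
      := a :* b :+ con (+ 0) :+ c :* d) refl (s 0) (t 1) (s 1) (t 0)
    ·-suc s t (suc n) = ≡.trans
      (cong (ℤ._+_ (s 0 ℤ.* t (suc (suc n)))) (·-suc (tail s) t n))
      (≡.sym (ℤ.+-assoc (s 0 ℤ.* t (suc (suc n))) _ _))

    ·-comm : ∀ s t → s · t ≗ t · s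
    ·-comm s t zero = cong (ℤ._+ + 0) (ℤ.*-comm (s 0) (t 0))
    ·-comm s t (suc n) = begin
      s 0 ℤ.* t (suc n) ℤ.+ (tail s · t) n ≡⟨ cong₂ ℤ._+_ (ℤ.*-comm (s 0) _) (·-comm (tail s) t n) ⟩
      t (suc n) ℤ.* s 0 ℤ.+ (t · tail s) n ≡⟨ ℤ.+-comm (t (suc n) ℤ.* s 0) _ ⟩
      (t · tail s) n ℤ.+ t (suc n) ℤ.* s 0 ≡⟨ ≡.sym (·-suc t s n) ⟩
      (t · s) (suc n)                      ∎
      where open ≡-Reasoning

    constant-* : ∀ a b → constant (a ℤ.* b) ≗ constant a · constant b
    constant-* a b zero    = ≡.sym (ℤ.+-identityʳ _)
    constant-* a b (suc n) = ≡.sym (cong₂ ℤ._+_ (ℤ.*-zeroʳ a) (·-zeroˡ (constant b) n))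

    q^-+ : ∀ m n → q^ (m ℕ.+ n) ≗ q^ m ⊛ q^ n
    q^-+ zero    n k       = ≡.sym (·-identityˡ (q^ n) k)
    q^-+ (suc m) n zero    = refl
    q^-+ (suc m) n (suc k) = ≡.trans (q^-+ m n k) (≡.sym (ℤ.+-identityˡ _))

    -- From here to `⊕-at`: facts about the opaque operations in a form usable where they do not
    -- unfold.
    ⊛-distribʳ : ∀ u s t n → ((s ⊕ t) ⊛ u) n ≡ (s ⊛ u) n ℤ.+ (t ⊛ u) n
    ⊛-distribʳ = ·-distribʳ

    ⊛-identityˡ : ∀ s n → (𝟏 ⊛ s) n ≡ s n
    ⊛-identityˡ = ·-identityˡ

    ⊛≡· : ∀ s t → s ⊛ t ≡ s · t
    ⊛≡· s t = refl

    [1-s]⊛t≡ : ∀ s t → (𝟏 ⊕ ⊖ s) ⊛ t ≡ (𝟏 Defs.- s) · t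
    [1-s]⊛t≡ s t = refl

    ⊖-at : ∀ s n → (⊖ s) n ≡ ℤ.- s n
    ⊖-at s n = refl

    ⊛-at-0 : ∀ s t → (s ⊛ t) 0 ≡ s 0 ℤ.* t 0
    ⊛-at-0 s t = ℤ.+-identityʳ _

    ⊕-at : ∀ s t n → (s ⊕ t) n ≡ s n ℤ.+ t n
    ⊕-at s t n = refl

infix 4 _≈[_]_

-- Equality modulo q^(N+1). There high powers of q vanish, so the finite identities above apply.
record _≈[_]_ (s : Series) (N : ℕ) (t : Series) : Set where
  constructor agree
  field at : ∀ {n} → n ≤ N → s n ≡ t n
open _≈[_]_

≗⇒≈ : ∀ {N s t} → s ≗ t → s ≈[ N ] t
≗⇒≈ s≗t .at {n} _ = s≗t n

opaque
  unfolding _⊕_ ⊖_ _⊛_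

  ⊛-cong : ∀ {N s s′ t t′} → s ≈[ N ] s′ → t ≈[ N ] t′ → s ⊛ t ≈[ N ] s′ ⊛ t′
  ⊛-cong s≈s′ t≈t′ .at {n} n≤N = sum-cong-≗ ℤ.+-0-commutativeMonoid λ j →
    cong₂ ℤ._*_ (s≈s′ .at (ℕ.≤-trans (toℕ≤pred[n] j) n≤N))
                (t≈t′ .at (ℕ.≤-trans (ℕ.m∸n≤m n (toℕ j)) n≤N))

  isCommutativeRing : ∀ N → IsCommutativeRing _≈[ N ]_ _⊕_ _⊛_ ⊖_ (λ _ → + 0) 𝟏
  isCommutativeRing N = record
    { isRing = record
      { +-isAbelianGroup = record
        { isGroup = record
          { isMonoid = record
            { isSemigroup = record
              { isMagma = record
                { isEquivalence = record
                  { refl = agree λ _ → refl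
                  ; sym = λ s≈t → agree λ n≤N → ≡.sym (s≈t .at n≤N)
                  ; trans = λ s≈t t≈u → agree λ n≤N → ≡.trans (s≈t .at n≤N) (t≈u .at n≤N)
                  }
                ; ∙-cong = λ s≈s′ t≈t′ → agree λ n≤N → cong₂ ℤ._+_ (s≈s′ .at n≤N) (t≈t′ .at n≤N)
                }
              ; assoc = λ s t u → ≗⇒≈ λ n → ℤ.+-assoc (s n) (t n) (u n)
              }
            ; identity = (λ s → ≗⇒≈ λ n → ℤ.+-identityˡ (s n)) , (λ s → ≗⇒≈ λ n → ℤ.+-identityʳ (s n))
            }
          ; inverse = (λ s → ≗⇒≈ λ n → ℤ.+-inverseˡ (s n)) , (λ s → ≗⇒≈ λ n → ℤ.+-inverseʳ (s n))
          ; ⁻¹-cong = λ s≈t → agree λ n≤N → cong ℤ.-_ (s≈t .at n≤N)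
          }
        ; comm = λ s t → ≗⇒≈ λ n → ℤ.+-comm (s n) (t n)
        }
      ; *-cong = ⊛-cong
      ; *-assoc = λ s t u → ≗⇒≈ (·-assoc s t u)
      ; *-identity = (λ s → ≗⇒≈ (·-identityˡ s)) ,
                     (λ s → ≗⇒≈ λ n → ≡.trans (·-comm s 𝟏 n) (·-identityˡ s n))
      ; distrib = (λ s t u → ≗⇒≈ λ n →
                    ≡.trans (·-comm s (t ⊕ u) n) (≡.trans (·-distribʳ s t u n)
                      (cong₂ ℤ._+_ (·-comm t s n) (·-comm u s n)))) ,
                  (λ s t u → ≗⇒≈ (·-distribʳ s t u))
      }
    ; *-comm = λ s t → ≗⇒≈ (·-comm s t)
    }

-- ℤ⟦q⟧/(q^(N+1))
truncated : ℕ → CommutativeRing _ _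
truncated N = record { isCommutativeRing = isCommutativeRing N }

opaque
  unfolding _⊕_ ⊖_ _⊛_

  constant-morphism : ∀ N → ℤ.+-*-rawRing -Raw-AlmostCommutative⟶ fromCommutativeRing (truncated N)
  constant-morphism N = record
    { ⟦_⟧    = constant
    ; +-homo = λ a b → ≗⇒≈ λ { zero → refl ; (suc n) → refl }
    ; *-homo = λ a b → ≗⇒≈ (constant-* a b)
    ; -‿homo = λ a → ≗⇒≈ λ { zero → refl ; (suc n) → refl }
    ; 0-homo = ≗⇒≈ λ { zero → refl ; (suc n) → refl }
    ; 1-homo = ≗⇒≈ λ { zero → refl ; (suc n) → refl }
    }

-- Supports modulo 8

-- For d = 0 the coefficients outside A vanish.
record Supported (d : ℤ) (A : ℕ → Set) (s : Series) : Set where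
  constructor supported
  field at : ∀ n → d ∣ˢ s n ⊎ A n
open Supported

supported-⊆ : ∀ {d A B s} → (∀ {n} → A n → B n) → Supported d A s → Supported d B s
supported-⊆ A⊆B s∈A .at n with s∈A .at n
... | inj₁ d∣sn = inj₁ d∣sn
... | inj₂ n∈A  = inj₂ (A⊆B n∈A)

supported-resp : ∀ {d A s t} → (∀ N → s ≈[ N ] t) → Supported d A s → Supported d A t
supported-resp {d} s≈t s∈A .at n with s∈A .at n
... | inj₁ d∣sn = inj₁ (≡.subst (d ∣ˢ_) (_≈[_]_.at (s≈t n) ℕ.≤-refl) d∣sn)
... | inj₂ n∈A  = inj₂ n∈A

opaque
  unfolding _⊕_ ⊖_ _⊛_

  supported-⊕ : ∀ {d A s t} → Supported d A s → Supported d A t → Supported d A (s ⊕ t)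
  supported-⊕ s∈A t∈A .at n with s∈A .at n | t∈A .at n
  ... | inj₂ n∈A  | _         = inj₂ n∈A
  ... | inj₁ _    | inj₂ n∈A  = inj₂ n∈A
  ... | inj₁ d∣sn | inj₁ d∣tn = inj₁ (∣m∣n⇒∣m+n d∣sn d∣tn)

  supported-⊖ : ∀ {d A s} → Supported d A s → Supported d A (⊖ s)
  supported-⊖ s∈A .at n with s∈A .at n
  ... | inj₁ d∣sn = inj₁ (∣m⇒∣-m d∣sn)
  ... | inj₂ n∈A  = inj₂ n∈A

  -- Follows the tail recursion of the product: passing to the tail of s shifts both A and C by one.
  supported-⊛ : ∀ {d A B C s t} → (∀ {i j} → A i → B j → C (i ℕ.+ j)) →
                Supported d A s → Supported d B t → Supported d C (s ⊛ t)
  supported-⊛ {d} {B = B} {C} {t = t} A+B⊆C s∈A t∈B .at n = go {C = C} A+B⊆C s∈A n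
    where
    term : ∀ {A C : ℕ → Set} {s} → (∀ {i j} → A i → B j → C (i ℕ.+ j)) → Supported d A s →
           ∀ n → d ∣ˢ s 0 ℤ.* t n ⊎ C n
    term {s = s} A+B⊆C s∈A n with s∈A .at 0 | t∈B .at n
    ... | inj₂ 0∈A  | inj₂ n∈B  = inj₂ (A+B⊆C 0∈A n∈B)
    ... | inj₁ d∣s0 | _         = inj₁ (∣m⇒∣m*n (t n) d∣s0)
    ... | inj₂ _    | inj₁ d∣tn = inj₁ (∣n⇒∣m*n (s 0) d∣tn)
    go : ∀ {A C : ℕ → Set} {s} → (∀ {i j} → A i → B j → C (i ℕ.+ j)) → Supported d A s →
         ∀ n → d ∣ˢ (s · t) n ⊎ C n
    go {C = C} A+B⊆C s∈A zero with term {C = C} A+B⊆C s∈A 0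
    ... | inj₁ d∣ = inj₁ (∣m∣n⇒∣m+n d∣ (divides (+ 0) refl))
    ... | inj₂ c  = inj₂ c
    go {C = C} A+B⊆C s∈A (suc n)
      with term {C = C} A+B⊆C s∈A (suc n)
         | go {C = λ n → C (suc n)} A+B⊆C (supported λ n → s∈A .at (suc n)) n
    ... | inj₂ c  | _       = inj₂ c
    ... | inj₁ _  | inj₂ c  = inj₂ c
    ... | inj₁ d∣ | inj₁ d∣′ = inj₁ (∣m∣n⇒∣m+n d∣ d∣′)

supported-𝟏 : ∀ {d} → Supported d (_≡ 0) 𝟏
supported-𝟏 .at zero    = inj₂ refl
supported-𝟏 .at (suc n) = inj₁ (divides (+ 0) refl)

supported-0 : ∀ {d A} → Supported d A (λ _ → + 0)
supported-0 .at n = inj₁ (divides (+ 0) refl)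

supported-∣ : ∀ {d e A s} → e ∣ˢ d → Supported d A s → Supported e A s
supported-∣ e∣d s∈A .at n with s∈A .at n
... | inj₁ d∣sn = inj₁ (∣-trans e∣d d∣sn)
... | inj₂ n∈A  = inj₂ n∈A

supported-at : ∀ {d A s n} → ¬ A n → Supported d A s → d ∣ˢ s n
supported-at {n = n} n∉A s∈A with s∈A .at n
... | inj₁ d∣sn = d∣sn
... | inj₂ n∈A  = ⊥-elim (n∉A n∈A)

record Mod8 (L : List ℕ) (n : ℕ) : Set where
  constructor mod8
  field residue : n % 8 ∈ L

-- The condition on sums of residues is decided during type checking, through the implicit `True`
-- argument.
mod8-+ : ∀ {L M K} {_ : True (All.all? (λ a → All.all? (λ b → (a ℕ.+ b) % 8 ∈? K) M) L)} →
         ∀ {i j} → Mod8 L i → Mod8 M j → Mod8 K (i ℕ.+ j)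
mod8-+ {K = K} {sums} {i} {j} (mod8 i∈L) (mod8 j∈M) =
  mod8 (≡.subst (_∈ K) (≡.sym (ℕ.%-distribˡ-+ i j 8))
                (All.lookup (All.lookup (toWitness sums) i∈L) j∈M))

mod8-⊆ : ∀ {L K} {L⊆K : True (All.all? (_∈? K) L)} → ∀ {n} → Mod8 L n → Mod8 K n
mod8-⊆ {L⊆K = L⊆K} (mod8 n∈L) = mod8 (All.lookup (toWitness L⊆K) n∈L)

-- Sharper than `mod8-+`, as no sums of distinct residues arise: 0, 1, 4 double to 0 and 2 only.
mod8-double : ∀ {L K} {doubles : True (All.all? (λ a → (a ℕ.+ a) % 8 ∈? K) L)} →
              ∀ {n} → Mod8 L n → Mod8 K (n ℕ.+ n)
mod8-double {K = K} {doubles} {n} (mod8 n∈L) =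
  mod8 (≡.subst (_∈ K) (≡.sym (ℕ.%-distribˡ-+ n n 8)) (All.lookup (toWitness doubles) n∈L))

mod8-square : ∀ n → Mod8 (0 ∷ 1 ∷ 4 ∷ []) (n ℕ.* n)
mod8-square n = mod8 (≡.subst (_∈ 0 ∷ 1 ∷ 4 ∷ []) (≡.sym (ℕ.%-distribˡ-* n n 8))
  (All.lookup {P = λ a → (a ℕ.* a) % 8 ∈ 0 ∷ 1 ∷ 4 ∷ []}
    (toWitness {a? = All.all? (λ a → (a ℕ.* a) % 8 ∈? 0 ∷ 1 ∷ 4 ∷ []) (upTo 8)} _)
    (∈-upTo⁺ (ℕ.m%n<n n 8))))

mod8-twice-square : ∀ n → Mod8 (0 ∷ 2 ∷ []) (n ℕ.* n ℕ.* 2)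
mod8-twice-square n = ≡.subst (Mod8 (0 ∷ 2 ∷ [])) n²+n²≡n²*2 (mod8-double (mod8-square n))
  where
  n²+n²≡n²*2 : n ℕ.* n ℕ.+ n ℕ.* n ≡ n ℕ.* n ℕ.* 2
  n²+n²≡n²*2 = ≡.trans (cong (n ℕ.* n ℕ.+_) (≡.sym (ℕ.+-identityʳ (n ℕ.* n)))) (ℕ.*-comm 2 (n ℕ.* n))

-- Squaring is additive modulo 2, so no mixed exponents of s and t arise.
supported-square : ∀ {A B s t} → (∀ {i j} → A i → A j → B (i ℕ.+ j)) → Supported (+ 0) A t →
  Supported (+ 2) B (s ⊛ s) → Supported (+ 2) B ((s ⊕ t) ⊛ (s ⊕ t))
supported-square {s = s} {t} A+A⊆B t∈A s²∈B = supported-resp expand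
  (supported-⊕ (supported-⊕ s²∈B (supported-∣ (divides (+ 0) refl) (supported-⊛ A+A⊆B t∈A t∈A)))
               (supported λ n → inj₁ (divides ((s ⊛ t) n)
                  (≡.trans (⊕-at (s ⊛ t) (s ⊛ t) n) (double ((s ⊛ t) n))))))
  where
  double : ∀ a → a ℤ.+ a ≡ a ℤ.* + 2
  double a = ≡.sym (≡.trans (ℤ.*-distribˡ-+ a (+ 1) (+ 1))
                            (cong₂ ℤ._+_ (ℤ.*-identityʳ a) (ℤ.*-identityʳ a)))
  expand : ∀ N → s ⊛ s ⊕ t ⊛ t ⊕ (s ⊛ t ⊕ s ⊛ t) ≈[ N ] (s ⊕ t) ⊛ (s ⊕ t)
  expand N = Theta.square-+ (truncated N) (constant-morphism N) s t

Even : Series → Set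
Even = Supported (+ 0) (Mod8 (0 ∷ 2 ∷ 4 ∷ 6 ∷ []))

power₀ : ∀ s → s 0 ≡ + 1 → ∀ e → power s e 0 ≡ + 1
power₀ s s₀≡1 zero    = refl
power₀ s s₀≡1 (suc e) rewrite s₀≡1 | power₀ s s₀≡1 e = refl

-- For c = e + 2 the exponents c - 1 and 2c - 3 are natural numbers.
overcubic-exponents : ∀ e → overcubic (2 ℕ.+ e) ≡
  power (f 4) (1 ℕ.+ e) ÷ (power (f 1) 2 · power (f 2) (1 ℕ.+ e ℕ.* 2))
overcubic-exponents e =
  cong (λ a → power (f 4) (1 ℕ.+ e) ÷ (power (f 1) 2 · f 2 Defs.^ a)) 2[2+e]-3≡1+2e
  where
  open ≡-Reasoning
  2[2+e]-3≡1+2e : + 2 ℤ.* + (2 ℕ.+ e) ℤ.- + 3 ≡ + (1 ℕ.+ e ℕ.* 2)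
  2[2+e]-3≡1+2e = begin
    + 2 ℤ.* + (2 ℕ.+ e) ℤ.- + 3 ≡⟨ cong (ℤ._- + 3) (ℤ.*-comm (+ 2) (+ (2 ℕ.+ e))) ⟩
    + (2 ℕ.+ e) ℤ.* + 2 ℤ.- + 3 ≡⟨ cong (ℤ._- + 3) (≡.sym (ℤ.pos-* (2 ℕ.+ e) 2)) ⟩
    + (1 ℕ.+ e ℕ.* 2)           ∎

-- The overcubic generating function up to q^N

module Truncated (N : ℕ) where

  open CommutativeRing (truncated N) hiding (refl; zero; _-_)
  open CommutativeRing (truncated N) using () renaming (refl to ≈-refl)
  open Theta (truncated N) (constant-morphism N)
  open import Algebra.Properties.Semiring.Exp semiring
  open import Relation.Binary.Reasoning.Setoid setoid

  power≡^ : ∀ s e → power s e ≡ s ^ e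
  power≡^ s zero    = refl
  power≡^ s (suc e) = ≡.trans (cong (s ·_) (power≡^ s e)) (≡.sym (⊛≡· s (s ^ e)))

  supported-^ : ∀ {d m s} → Supported d (_≡ m) s → ∀ n → Supported d (_≡ n ℕ.* m) (s ^ n)
  supported-^ s∈m zero    = supported-𝟏
  supported-^ s∈m (suc n) = supported-⊛ (cong₂ ℕ._+_) s∈m (supported-^ s∈m n)

  supported-sgn : ∀ {d} n → Supported d (_≡ 0) (sgn n)
  supported-sgn zero    = supported-𝟏
  supported-sgn (suc n) = supported-⊖ (supported-sgn n)

  supported-monomial : ∀ {d m s} → Supported d (_≡ m) s → ∀ n →
                       Supported d (_≡ n ℕ.* n ℕ.* m) (sgn n * s ^ (n ℕ.* n))
  supported-monomial s∈m n =
    supported-⊛ (cong₂ ℕ._+_) (supported-sgn n) (supported-^ s∈m (n ℕ.* n))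

  supported-squares : ∀ {d A m s} → Supported d (_≡ m) s → (∀ n → A (n ℕ.* n ℕ.* m)) →
                      ∀ n → Supported d A (squares s n)
  supported-squares s∈m n²m∈A zero    = supported-0
  supported-squares {A = A} s∈m n²m∈A (suc n) = supported-⊕
    (supported-squares s∈m n²m∈A n)
    (supported-⊆ (λ i≡ → ≡.subst A (≡.sym i≡) (n²m∈A (suc n))) (supported-monomial s∈m (suc n)))

  -- Modulo 2 the square of a sum of terms ±q^(2n²) is the sum of the q^(4n²), and 4n² is 0 or 4
  -- modulo 8.
  supported-squares² : ∀ {s} → Supported (+ 0) (_≡ 2) s →
    ∀ n → Supported (+ 2) (Mod8 (0 ∷ 4 ∷ [])) (squares s n * squares s n)
  supported-squares² s∈2 zero =
    supported-⊛ {A = λ _ → ⊥} {B = λ _ → ⊥} (λ ()) supported-0 supported-0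
  supported-squares² s∈2 (suc n) = supported-square
    (λ i≡ j≡ → ≡.subst (Mod8 (0 ∷ 4 ∷ [])) (≡.sym (cong₂ ℕ._+_ i≡ j≡))
                       (mod8-double (mod8-twice-square (suc n))))
    (supported-monomial s∈2 (suc n)) (supported-squares² s∈2 n)

  vanishes : ∀ {m s} → N ℕ.< m → Supported (+ 0) (_≡ m) s → s ≈ 0#
  vanishes N<m s∈m = agree λ n≤N →
    0∣⇒≡0 (supported-at (ℕ.<⇒≢ (ℕ.≤-<-trans n≤N N<m)) s∈m)

  ·-inverseˡ : ∀ {s} → s 0 ≡ + 1 → inverse s * s ≈ 1#
  ·-inverseˡ {s} s₀≡1 = trans (*-comm (inverse s) s)
    (trans (reflexive (⊛≡· s (inverse s))) (≗⇒≈ (·-inverse s s₀≡1)))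

  inverse-1+ : Series → ℕ → Series
  inverse-1+ s n = inverse (1# + s ^ suc n)

  inverses : ∀ {s} → s 0 ≡ + 0 → Inverses s (inverse-1+ s)
  inverses {s} s₀≡0 n = ·-inverseˡ (≡.trans (⊕-at 𝟏 (s ^ suc n) 0)
    (cong (ℤ._+_ (+ 1)) (≡.trans (⊛-at-0 s (s ^ n)) (cong (ℤ._* (s ^ n) 0) s₀≡0))))

  q^-power : ∀ k n → (q^ k) ^ n ≈ q^ (k ℕ.* n)
  q^-power k zero    = reflexive (cong q^_ (≡.sym (ℕ.*-zeroʳ k)))
  q^-power k (suc n) = begin
    q^ k * (q^ k) ^ n   ≈⟨ *-congˡ (q^-power k n) ⟩
    q^ k * q^ (k ℕ.* n) ≈⟨ ≗⇒≈ (λ i → ≡.sym (q^-+ k (k ℕ.* n) i)) ⟩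
    q^ (k ℕ.+ k ℕ.* n)  ≈⟨ reflexive (cong q^_ (≡.sym (ℕ.*-suc k n))) ⟩
    q^ (k ℕ.* suc n)    ∎

  euler-cong : ∀ {s t} → s ≈ t → ∀ n → euler s n ≈ euler t n
  euler-cong s≈t zero    = ≈-refl
  euler-cong s≈t (suc n) =
    *-cong (+-congˡ (-‿cong (*-cong s≈t (^-congˡ n s≈t)))) (euler-cong s≈t n)

  partialProduct≈euler : ∀ k n → partialProduct k n ≈ euler (q^ k) n
  partialProduct≈euler k zero    = ≈-refl
  partialProduct≈euler k (suc n) =
    trans (reflexive (≡.sym ([1-s]⊛t≡ (q^ (k ℕ.* suc n)) (partialProduct k n))))
          (*-cong (+-congˡ (-‿cong (sym (q^-power k (suc n))))) (partialProduct≈euler k n))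

  f≈euler : ∀ k .{{_ : NonZero k}} {M} → N ≤ M → ∀ {s} → q^ k ≈ s → f k ≈ euler s M
  f≈euler k {M} N≤M {s} q^k≈s = begin
    f k                ≈⟨ agree (λ n≤N → ≡.sym (partialProduct-stable k (ℕ.≤-trans n≤N N≤M))) ⟩
    partialProduct k M ≈⟨ partialProduct≈euler k M ⟩
    euler (q^ k) M     ≈⟨ euler-cong q^k≈s M ⟩
    euler s M          ∎

  q q² : Series
  q  = q^ 1
  q² = q * q

  supported-q : ∀ {d} → Supported d (_≡ 1) q
  supported-q .at zero          = inj₁ (divides (+ 0) refl)
  supported-q .at (suc zero)    = inj₂ refl
  supported-q .at (suc (suc n)) = inj₁ (divides (+ 0) refl)

  supported-q² : ∀ {d} → Supported d (_≡ 2) q²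
  supported-q² = supported-⊛ (cong₂ ℕ._+_) supported-q supported-q

  -- The length `N ℕ.* 2` fits `ratio-neg`, where 2N factors in ±q face N factors in q².
  v x : Series
  v = squares (- q) (N ℕ.* 2)
  x = squares q² N

  -- φ(-q), φ(q) and φ(-q²), up to q^N
  T V U : Series
  T = theta q (N ℕ.* 2)
  V = theta (- q) (N ℕ.* 2)
  U = theta q² N

  N≤N*2 : N ≤ N ℕ.* 2
  N≤N*2 = ℕ.m≤m*n N 2

  q-inv : Inverses q (inverse-1+ q)
  q-inv = inverses {q} refl

  -q-inv : Inverses (- q) (inverse-1+ (- q))
  -q-inv = inverses { - q } (⊖-at q 0)

  q²-inv : Inverses q² (inverse-1+ q²)
  q²-inv = inverses {q²} (⊛-at-0 q q)

  power-vanishes : ∀ {m s} .{{_ : NonZero m}} → Supported (+ 0) (_≡ m) s →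
                   ∀ {n} → N ≤ n → s ^ suc n ≈ 0#
  power-vanishes {m} s∈m {n} N≤n =
    vanishes (ℕ.<-≤-trans (s≤s N≤n) (ℕ.m≤m*n (suc n) m)) (supported-^ s∈m (suc n))

  T≈ : T ≈ ratio q (inverse-1+ q) (N ℕ.* 2)
  T≈ = theta≈ratio q-inv (N ℕ.* 2) (power-vanishes supported-q N≤N*2)

  V≈ : V ≈ ratio (- q) (inverse-1+ (- q)) (N ℕ.* 2)
  V≈ = theta≈ratio -q-inv (N ℕ.* 2) (power-vanishes (supported-⊖ supported-q) N≤N*2)

  U≈ : U ≈ ratio q² (inverse-1+ q²) N
  U≈ = theta≈ratio q²-inv N (power-vanishes supported-q² ℕ.≤-refl)

  T*V≈U*U : T * V ≈ U * U
  T*V≈U*U = begin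
    T * V ≈⟨ *-cong T≈ V≈ ⟩
    ratio q (inverse-1+ q) (N ℕ.* 2) * ratio (- q) (inverse-1+ (- q)) (N ℕ.* 2)
          ≈⟨ ratio-neg q-inv -q-inv q²-inv N ⟩
    ratio q² (inverse-1+ q²) N * ratio q² (inverse-1+ q²) N
          ≈⟨ sym (*-cong U≈ U≈) ⟩
    U * U ∎

  q^2≈q² : q^ 2 ≈ q²
  q^2≈q² = ≗⇒≈ (q^-+ 1 1)

  q^4≈q²*q² : q^ 4 ≈ q² * q²
  q^4≈q²*q² = trans (≗⇒≈ (q^-+ 2 2)) (*-cong q^2≈q² q^2≈q²)

  T*f₂≈f₁*f₁ : T * f 2 ≈ f 1 * f 1
  T*f₂≈f₁*f₁ = begin
    T * f 2
      ≈⟨ *-cong T≈ (f≈euler 2 N≤N*2 q^2≈q²) ⟩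
    ratio q (inverse-1+ q) (N ℕ.* 2) * euler q² (N ℕ.* 2)
      ≈⟨ ratio*euler q-inv (N ℕ.* 2) ⟩
    euler q (N ℕ.* 2) * euler q (N ℕ.* 2)
      ≈⟨ sym (*-cong (f≈euler 1 N≤N*2 ≈-refl) (f≈euler 1 N≤N*2 ≈-refl)) ⟩
    f 1 * f 1 ∎

  U*f₄≈f₂*f₂ : U * f 4 ≈ f 2 * f 2
  U*f₄≈f₂*f₂ = begin
    U * f 4
      ≈⟨ *-cong U≈ (f≈euler 4 ℕ.≤-refl q^4≈q²*q²) ⟩
    ratio q² (inverse-1+ q²) N * euler (q² * q²) N
      ≈⟨ ratio*euler q²-inv N ⟩
    euler q² N * euler q² N
      ≈⟨ sym (*-cong (f≈euler 2 ℕ.≤-refl q^2≈q²) (f≈euler 2 ℕ.≤-refl q^2≈q²)) ⟩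
    f 2 * f 2 ∎

  overcubic*U^≈V*U : ∀ e → overcubic (2 ℕ.+ e) * U ^ (4 ℕ.+ e) ≈ V * U
  overcubic*U^≈V*U e = theta-quotient (·-inverseˡ refl) T*f₂≈f₁*f₁ U*f₄≈f₂*f₂ T*V≈U*U e (begin
    overcubic (2 ℕ.+ e) * (f 1 ^ 2 * f 2 ^ (1 ℕ.+ e ℕ.* 2))
      ≡⟨ cong₂ _*_ (overcubic-exponents e)
                   (≡.trans (≡.sym (cong₂ _*_ (power≡^ (f 1) 2) (power≡^ (f 2) (1 ℕ.+ e ℕ.* 2))))
                            (⊛≡· (power (f 1) 2) (power (f 2) (1 ℕ.+ e ℕ.* 2)))) ⟩
    P · inverse D * D
      ≡⟨ cong (_* D) (≡.sym (⊛≡· P (inverse D))) ⟩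
    P * inverse D * D
      ≈⟨ *-assoc P (inverse D) D ⟩
    P * (inverse D * D)
      ≈⟨ *-congˡ (·-inverseˡ D₀≡1) ⟩
    P * 1#
      ≈⟨ *-identityʳ P ⟩
    P
      ≡⟨ power≡^ (f 4) (1 ℕ.+ e) ⟩
    f 4 ^ (1 ℕ.+ e) ∎)
    where
    P = power (f 4) (1 ℕ.+ e)
    D = power (f 1) 2 · power (f 2) (1 ℕ.+ e ℕ.* 2)
    D₀≡1 : D 0 ≡ + 1
    D₀≡1 rewrite power₀ (f 2) refl (1 ℕ.+ e ℕ.* 2) = refl

  -- Supports of the theta series and divisibility of the coefficient of q^N

  v-support : ∀ {d} → Supported d (Mod8 (0 ∷ 1 ∷ 4 ∷ [])) v
  v-support = supported-squares (supported-⊖ supported-q)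
    (λ n → ≡.subst (Mod8 (0 ∷ 1 ∷ 4 ∷ [])) (≡.sym (ℕ.*-identityʳ (n ℕ.* n))) (mod8-square n))
    (N ℕ.* 2)

  x-support : ∀ {d} → Supported d (Mod8 (0 ∷ 2 ∷ [])) x
  x-support = supported-squares supported-q² mod8-twice-square N

  supported-theta : ∀ {d L s} {_ : True (0 ∈? L)} →
                    Supported d (Mod8 L) s → Supported d (Mod8 L) (1# + (s + s))
  supported-theta {L = L} {_} {0∈L} s∈L =
    supported-⊕ (supported-⊆ (λ { refl → mod8 (toWitness 0∈L) }) supported-𝟏) (supported-⊕ s∈L s∈L)

  V*U-support : Supported (+ 0) (Mod8 (0 ∷ 1 ∷ 2 ∷ 3 ∷ 4 ∷ 6 ∷ [])) (V * U)
  V*U-support = supported-⊛ mod8-+ (supported-theta v-support) (supported-theta x-support)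

  -- Modulo 2 the exponents in x + x² are of the form 2b² or 4b². Adding a square never gives 7
  -- modulo 8, while 5 = 1 + 4 remains possible; this costs 8n + 5 one power of two.
  v*y-support : Supported (+ 2) (Mod8 (0 ∷ 1 ∷ 2 ∷ 3 ∷ 4 ∷ 5 ∷ 6 ∷ [])) (v * (x + x * x))
  v*y-support = supported-⊛ (mod8-+ {M = 0 ∷ 2 ∷ 4 ∷ []}) v-support
    (supported-⊕ (supported-⊆ mod8-⊆ x-support)
                 (supported-⊆ mod8-⊆ (supported-squares² supported-q² N)))

  even-x : Even x
  even-x = supported-⊆ mod8-⊆ x-support

  even-· : ∀ {s t} → Even s → Even t → Even (s * t)
  even-· = supported-⊛ mod8-+

  even-𝟏 : Even 𝟏
  even-𝟏 = supported-⊆ (λ { refl → mod8 (here refl) }) supported-𝟏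

  overcubic-expansion : ∀ e i j → 4 ℕ.+ e ≡ 2 ℕ.^ suc j ℕ.* suc (2 ℕ.* i) →
    let p = pow2 (2 ℕ.+ j) in
    ∃ λ W → ∃ λ H → Even W ×
      overcubic (2 ℕ.+ e) ≈ V * U + p * W + (p + p) * (- (v * (x + x * x))) + (p + p + (p + p)) * H
  overcubic-expansion e i j 4+e≡ =
    let z , z∈E , U^≈ = Near-power Even supported-0 even-𝟏 supported-⊕ even-· even-x j i
        H , G≈ = expansion {v = v} {x} {x + x * x} {z} j
                   (overcubic*U^≈V*U e) (trans (^-congʳ U 4+e≡) U^≈)
    in - ((x + x * x + (z + z)) * U) , H ,
       supported-⊖ (even-· (supported-⊕ even-y (supported-⊕ z∈E z∈E)) (supported-theta even-x)) , G≈
    where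
    even-y : Even (x + x * x)
    even-y = supported-⊕ even-x (even-· even-x even-x)

  pow2-* : ∀ j s n → (pow2 j * s) n ≡ + (2 ℕ.^ j) ℤ.* s n
  pow2-* zero    s n = ≡.trans (⊛-identityˡ s n) (≡.sym (ℤ.*-identityˡ (s n)))
  pow2-* (suc j) s n =
    ≡.trans (⊛-distribʳ s (pow2 j) (pow2 j) n)
    (≡.trans (cong₂ ℤ._+_ (pow2-* j s n) (pow2-* j s n))
    (≡.trans (≡.sym (ℤ.*-distribʳ-+ (s n) (+ (2 ℕ.^ j)) (+ (2 ℕ.^ j))))
             (cong (λ m → + (2 ℕ.^ j ℕ.+ m) ℤ.* s n) (≡.sym (ℕ.+-identityʳ (2 ℕ.^ j))))))

  -- The truncation order N is also the index of the coefficient. By hypothesis N is 5 or 7 modulo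
  -- 8, so V U and the even series W contribute nothing. The summand with v (x + x²) is left to a
  -- hypothesis, since the two residues differ there.
  overcubic-divisible : ∀ {d} e i j → 4 ℕ.+ e ≡ 2 ℕ.^ suc j ℕ.* suc (2 ℕ.* i) →
    ¬ Mod8 (0 ∷ 1 ∷ 2 ∷ 3 ∷ 4 ∷ 6 ∷ []) N →
    d ∣ˢ + (2 ℕ.^ (4 ℕ.+ j)) →
    d ∣ˢ + (2 ℕ.^ (3 ℕ.+ j)) ℤ.* (- (v * (x + x * x))) N →
    d ∣ˢ overcubic (2 ℕ.+ e) N
  overcubic-divisible {d} e i j 4+e≡ N∉ d∣2^[4+j] d∣vy =
    let W , H , W-even , G≈ = overcubic-expansion e i j 4+e≡ in
    ≡.subst (d ∣ˢ_) (≡.sym (_≈[_]_.at G≈ ℕ.≤-refl))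
      (∣-⊕ (∣-⊕ (∣-⊕ (0∣⇒∣ (supported-at N∉ V*U-support))
                     (∣-pow2-* (2 ℕ.+ j) (∣n⇒∣m*n (+ (2 ℕ.^ (2 ℕ.+ j)))
                       (0∣⇒∣ (supported-at N∉even W-even)))))
                (∣-pow2-* (3 ℕ.+ j) d∣vy))
           (∣-pow2-* (4 ℕ.+ j) (∣m⇒∣m*n (H N) d∣2^[4+j])))
    where
    ∣-⊕ : ∀ {s t} → d ∣ˢ s N → d ∣ˢ t N → d ∣ˢ (s ⊕ t) N
    ∣-⊕ {s} {t} d∣s d∣t = ≡.subst (d ∣ˢ_) (≡.sym (⊕-at s t N)) (∣m∣n⇒∣m+n d∣s d∣t)
    ∣-pow2-* : ∀ j {s} → d ∣ˢ + (2 ℕ.^ j) ℤ.* s N → d ∣ˢ (pow2 j * s) N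
    ∣-pow2-* j {s} = ≡.subst (d ∣ˢ_) (≡.sym (pow2-* j s N))
    0∣⇒∣ : ∀ {a} → + 0 ∣ˢ a → d ∣ˢ a
    0∣⇒∣ 0∣a = ∣-trans (divides (+ 0) refl) 0∣a
    N∉even : ¬ Mod8 (0 ∷ 2 ∷ 4 ∷ 6 ∷ []) N
    N∉even N∈ = N∉ (mod8-⊆ N∈)

-- The residues 5 and 7, and the index c

mod8-∉ : ∀ {L} r {_ : False (r % 8 ∈? L)} → ∀ n → ¬ Mod8 L (8 ℕ.* n ℕ.+ r)
mod8-∉ {L} r {r∉L} n (mod8 ∈L) = toWitnessFalse r∉L (≡.subst (_∈ L) [8n+r]%8≡r%8 ∈L)
  where
  [8n+r]%8≡r%8 : (8 ℕ.* n ℕ.+ r) % 8 ≡ r % 8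
  [8n+r]%8≡r%8 = ≡.trans (cong (_% 8) (≡.trans (ℕ.+-comm (8 ℕ.* n) r) (cong (r ℕ.+_) (ℕ.*-comm 8 n))))
                         (ℕ.[m+kn]%n≡m%n r n 8)

pow2-suc : ∀ n → + (2 ℕ.^ suc n) ≡ + (2 ℕ.^ n) ℤ.* + 2
pow2-suc n = ≡.trans (cong +_ (ℕ.*-comm 2 (2 ℕ.^ n))) (ℤ.pos-* (2 ℕ.^ n) 2)

2^[1+n]∣2^n* : ∀ n {a} → + 2 ∣ˢ a → + (2 ℕ.^ suc n) ∣ˢ + (2 ℕ.^ n) ℤ.* a
2^[1+n]∣2^n* n {a} 2∣a =
  ≡.subst (_∣ˢ + (2 ℕ.^ n) ℤ.* a) (≡.sym (pow2-suc n)) (*-monoʳ-∣ (+ (2 ℕ.^ n)) 2∣a)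

-- At 8n + 5 the critical summand is divisible through its factor 2^(3+j) alone; at 8n + 7 its
-- cofactor is even as well.
overcubic-mod8 : ∀ n e i j → 4 ℕ.+ e ≡ 2 ℕ.^ suc j ℕ.* suc (2 ℕ.* i) →
  + (2 ℕ.^ (3 ℕ.+ j)) ∣ˢ overcubic (2 ℕ.+ e) (8 ℕ.* n ℕ.+ 5) ×
  + (2 ℕ.^ (4 ℕ.+ j)) ∣ˢ overcubic (2 ℕ.+ e) (8 ℕ.* n ℕ.+ 7)
overcubic-mod8 n e i j 4+e≡ =
  Truncated.overcubic-divisible (8 ℕ.* n ℕ.+ 5) e i j 4+e≡ (mod8-∉ 5 n)
    (divides (+ 2) (≡.trans (pow2-suc (3 ℕ.+ j)) (ℤ.*-comm (+ (2 ℕ.^ (3 ℕ.+ j))) (+ 2))))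
    (∣m⇒∣m*n _ ∣-refl) ,
  Truncated.overcubic-divisible (8 ℕ.* n ℕ.+ 7) e i j 4+e≡ (mod8-∉ 7 n)
    ∣-refl
    (2^[1+n]∣2^n* (3 ℕ.+ j)
      (supported-at (mod8-∉ 7 n) (supported-⊖ (Truncated.v*y-support (8 ℕ.* n ℕ.+ 7)))))

-- With k = 3 + κ and the original i written as `suc i`, c + 2 is the number m = 2^(k-1)(2i + 1). It
-- is at least 4, so e = m - 4 involves no truncated subtraction.
overcubic-index : ∀ i κ → ∃ λ e →
  2 ℕ.^ (3 ℕ.+ κ) ℕ.* suc i ℕ.∸ 2 ℕ.^ (2 ℕ.+ κ) ℕ.∸ 2 ≡ 2 ℕ.+ e ×
  4 ℕ.+ e ≡ 2 ℕ.^ (2 ℕ.+ κ) ℕ.* suc (2 ℕ.* i)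
overcubic-index i κ = m ℕ.∸ 4 , index , 4+[m∸4]≡m
  where
  open ≡-Reasoning
  a = 2 ℕ.^ (2 ℕ.+ κ)
  m = a ℕ.* suc (2 ℕ.* i)
  4+[m∸4]≡m : 4 ℕ.+ (m ℕ.∸ 4) ≡ m
  4+[m∸4]≡m = ℕ.m+[n∸m]≡n (ℕ.≤-trans (ℕ.^-monoʳ-≤ 2 (s≤s (s≤s (z≤n {κ})))) (ℕ.m≤m*n a (suc (2 ℕ.* i))))
  index : 2 ℕ.* a ℕ.* suc i ℕ.∸ a ℕ.∸ 2 ≡ 2 ℕ.+ (m ℕ.∸ 4)
  index = begin
    2 ℕ.* a ℕ.* suc i ℕ.∸ a ℕ.∸ 2 ≡⟨ cong (λ b → b ℕ.∸ a ℕ.∸ 2)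
      (ℕ-Solver.solve 2 (λ a i → con 2 :* a :* (con 1 :+ i) := a :+ a :* (con 1 :+ con 2 :* i)) refl a i) ⟩
    a ℕ.+ m ℕ.∸ a ℕ.∸ 2           ≡⟨ cong (ℕ._∸ 2) (ℕ.m+n∸m≡n a m) ⟩
    m ℕ.∸ 2                       ≡⟨ cong (ℕ._∸ 2) (≡.sym 4+[m∸4]≡m) ⟩
    2 ℕ.+ (m ℕ.∸ 4)               ∎
    where open ℕ-Solver using (con; _:*_; _:+_; _:=_)

open import Data.Nat.Base using (_+_; _*_; _∸_; _^_; _≥_)

theorem1p7 : (n i k : ℕ) → i ≥ 1 → k ≥ 3 →
    ((+ (2 ^ (k + 1))) ∣ overcubic (2 ^ k * i ∸ 2 ^ (k ∸ 1) ∸ 2) (8 * n + 5)) ×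
    ((+ (2 ^ (k + 2))) ∣ overcubic (2 ^ k * i ∸ 2 ^ (k ∸ 1) ∸ 2) (8 * n + 7))
theorem1p7 n (suc i) (suc (suc (suc κ))) _ _ =
  let e , c≡2+e , 4+e≡ = overcubic-index i κ
      -- j = k - 2, which makes 3 + j and 4 + j equal to k + 1 and k + 2.
      d₅ , d₇ = overcubic-mod8 n e i (suc κ) 4+e≡
  in unsigned c≡2+e (ℕ.+-comm 1 (3 + κ)) (8 * n + 5) d₅ ,
     unsigned c≡2+e (ℕ.+-comm 2 (3 + κ)) (8 * n + 7) d₇
  where
  unsigned : ∀ {c c′ a b} → c ≡ c′ → a ≡ b → ∀ m →
             + (2 ^ a) ∣ˢ overcubic c′ m → + (2 ^ b) ∣ overcubic c m
  unsigned refl refl m = ∣⇒∣ᵤ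
theorem1p7 n (suc i) (suc zero) _ (s≤s ())
theorem1p7 n (suc i) (suc (suc zero)) _ (s≤s (s≤s ()))
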